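{- Let $n,k\geq 1$ be integers and write $n=p2^q$ with $p$ odd and $q\geq 0$ an integer. Let $H_{2n}^k$ denote the Cartesian product $K_{2n}\square K_{2n}\square\cdots\square K_{2n}$ of $k$ copies of the complete graph $K_{2n}$. Then (1) $H_{2n}^k\in\mathfrak{N}$; (2) $w(H_{2n}^k)=(2n-1)k$; (3) $W(H_{2n}^k)\geq (4n-2-p-q)k$.
   Context: All graphs are finite, undirected, without loops or multiple edges. An edge coloring of a graph $G$ with colors $1,2,\ldots,t$ is an interval $t$-coloring if every color $i\in\{1,\ldots,t\}$ is used on at least one edge, and for every vertex $v$ the colors of the edges incident to $v$ are pairwise distinct and form an interval of consecutive integers. $G$ is interval colorable if it has an interval $t$-coloring for some integer $t\geq 1$; $\mathfrak{N}$ denotes the set of interval colorable graphs. For $G\in\mathfrak{N}$, $w(G)$ and $W(G)$ denote the least and greatest $t$ for which $G$ has an interval $t$-coloring. The Cartesian product $G\square H$ has vertex set $V(G)\times V(H)$, with $(u_1,v_1)$ adjacent to $(u_2,v_2)$ iff either ($u_1=u_2$ and $v_1v_2\in E(H)$) or ($v_1=v_2$ and $u_1u_2\in E(G)$). -}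

module Defs where

open import Data.Nat using (ℕ; zero; suc; _≤_; _*_)
open import Data.Fin using (Fin)
open import Data.Product using (Σ; ∃; _×_; _,_)
open import Data.Sum using (_⊎_)
open import Relation.Binary.PropositionalEquality using (_≡_; _≢_)

record Graph : Set₁ where
  field
    V   : Set
    Adj : V → V → Set
open Graph public

K : ℕ → Graph
K m = record { V = Fin m ; Adj = λ i j → i ≢ j }

_□_ : Graph → Graph → Graph
G □ H = record
  { V   = V G × V H
  ; Adj = λ { (u₁ , v₁) (u₂ , v₂) →
              (u₁ ≡ u₂ × Adj H v₁ v₂) ⊎ (v₁ ≡ v₂ × Adj G u₁ u₂) } }

_^□_ : Graph → ℕ → Graph
G ^□ zero          = K 1
G ^□ suc zero      = G
G ^□ suc (suc k)   = (G ^□ suc k) □ G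

Hyp : ℕ → ℕ → Graph
Hyp n k = K (2 * n) ^□ k

-- An interval t-coloring of G: c assigns a colour to each (ordered) pair of
-- vertices; only its values on adjacent pairs matter.
record IsIntervalColoring (G : Graph) (t : ℕ) (c : V G → V G → ℕ) : Set where
  field
    symm     : ∀ u v → Adj G u v → c u v ≡ c v u
    range    : ∀ u v → Adj G u v → 1 ≤ c u v × c u v ≤ t
    allUsed  : ∀ i → 1 ≤ i → i ≤ t → Σ (V G) λ u → Σ (V G) λ v → Adj G u v × c u v ≡ i
    proper   : ∀ v u u′ → Adj G v u → Adj G v u′ → c v u ≡ c v u′ → u ≡ u′
    interval : ∀ v u u′ → Adj G v u → Adj G v u′ → ∀ j → c v u ≤ j → j ≤ c v u′ →
               Σ (V G) λ u″ → Adj G v u″ × c v u″ ≡ j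

HasIntervalColoring : Graph → ℕ → Set
HasIntervalColoring G t = Σ (V G → V G → ℕ) λ c → IsIntervalColoring G t c

IntervalColorable : Graph → Set
IntervalColorable G = Σ ℕ λ t → 1 ≤ t × HasIntervalColoring G t

IsLeastColors : Graph → ℕ → Set
IsLeastColors G w = HasIntervalColoring G w × (∀ t → HasIntervalColoring G t → w ≤ t)

IsGreatestColors : Graph → ℕ → Set
IsGreatestColors G W = HasIntervalColoring G W × (∀ t → HasIntervalColoring G t → t ≤ W)

{-# OPTIONS --safe #-}
module Submission where

-- Call an interval colouring regular if every vertex sees exactly r consecutive
-- colours.  Reduced modulo r, a regular colouring uses only r colours, and r
-- colours are needed at any single vertex; colourings of G and H with t and t′
-- colours combine to one of G □ H with t + t′ colours.  So everything reduces
-- to a regular colouring of K_{2n} with 4n − 2 − p − q colours: K_{2p} has one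
-- with 3p − 2 colours (Kamalian), and one of K_M with t colours yields one of
-- K_{2M} with t + 2M − 1 (Petrosyan).  The greatest number of colours exists
-- constructively because t-colourability of a finite graph is decidable and t
-- is at most the number of ordered pairs of vertices.

open import Defs
open import Data.Nat using (ℕ; zero; suc; pred; _≤_; _<_; _*_; _+_; _∸_; _^_; _⊓_; _%_; NonZero; z≤n; s≤s; s≤s⁻¹; _≤?_; _<?_)
import Data.Nat as ℕ
open import Data.Nat.Properties
open import Data.Nat.DivMod using (m%n<n; m<n⇒m%n≡m; [m+n]%n≡m%n)
open import Data.Nat.Divisibility using (_∣_)
open import Data.Nat.Tactic.RingSolver using (solve-∀)
open import Data.Fin using (Fin; zero; suc; toℕ; fromℕ<; funToFin; finToFun)
open import Data.Fin.Properties
  using (any?; all?; toℕ<n; toℕ-injective; toℕ-fromℕ<; fromℕ<-injective; injective⇒≤; punchOut-injective; finToFun-funToFin; +↔⊎; *↔×)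
  renaming (_≟_ to _≟ᶠ_)
open import Data.Product using (Σ; ∃; _×_; _,_; proj₁; proj₂)
open import Data.Product.Function.NonDependent.Propositional using (_×-↔_)
open import Data.Sum using (_⊎_; inj₁; inj₂)
open import Data.Sum.Properties using (inj₁-injective; inj₂-injective)
open import Function using (_∘_; _↔_; Inverse; Injection)
open import Function.Properties.Inverse using (↔⇒↣)
open import Function.Construct.Composition using (_↔-∘_)
open import Function.Construct.Symmetry using (↔-sym)
open import Function.Construct.Identity using (↔-id)
open import Relation.Nullary using (¬_; Dec; yes; no; contradiction)
open import Relation.Nullary.Decidable using (map′; via-injection; ¬?; _×-dec_; _⊎-dec_; _→-dec_)
open import Relation.Binary.Definitions using (DecidableEquality; tri<; tri≈; tri>)
open import Relation.Binary.PropositionalEquality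

-- Splitting of ranges, pigeonhole, residues, and bounded search.

below⊎above : ∀ a {b j} → j < a + b → j < a ⊎ ∃ λ k → k < b × a + k ≡ j
below⊎above a {b} {j} j<a+b with j <? a
... | yes j<a = inj₁ j<a
... | no  j≮a = inj₂ (j ∸ a , +-cancelˡ-< a (j ∸ a) b (subst (_< a + b) (sym eq) j<a+b) , eq)
  where eq = m+[n∸m]≡n (≮⇒≥ j≮a)

∀<? : ∀ {P : ℕ → Set} → (∀ i → Dec (P i)) → ∀ b → Dec (∀ i → i < b → P i)
∀<? P? b = map′ (λ f i → f {i}) (λ f {i} → f i) (allUpTo? P? b)

injective⇒surjective : ∀ {n} {f : Fin n → Fin n} → (∀ {i j} → f i ≡ f j → i ≡ j) → ∀ y → ∃ λ x → f x ≡ y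
injective⇒surjective {suc n} {f} inj y with any? (λ x → f x ≟ᶠ y)
... | yes hit  = hit
... | no  miss = contradiction (injective⇒≤ (inj ∘ punchOut-injective y≢f y≢f)) 1+n≰n
  where
  y≢f : ∀ {x} → y ≢ f x
  y≢f {x} eq = miss (x , sym eq)

-- Induction on `s`: raising `s` by one lowers the offset by one. Offset 0 wraps round to `r-1`,
-- because `suc s + r-1` is `s + r`.
residue-hit : ∀ r .{{_ : NonZero r}} s {j} → j < r → ∃ λ k → k < r × (s + k) % r ≡ j
residue-hit r@(suc _) zero {j} j<r = j , j<r , m<n⇒m%n≡m j<r
residue-hit r@(suc r-1) (suc s) j<r with residue-hit r s j<r
... | suc k , k<r , eq = k , <⇒≤ k<r , trans (cong (_% r) (sym (+-suc s k))) eq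
... | zero  , _   , eq = r-1 , ≤-refl ,
  trans (cong (_% r) (sym (+-suc s r-1)))
        (trans ([m+n]%n≡m%n s r) (trans (cong (_% r) (sym (+-identityʳ s))) eq))

-- `section` picks for each residue an offset below `r` that attains it. The residue can be read off
-- from that offset, so `section` is injective on `Fin r` and hence surjective. Every offset is
-- therefore the one picked for its own residue, and the residue determines it.
residue-injective : ∀ r .{{_ : NonZero r}} s {j k} → j < r → k < r → (s + j) % r ≡ (s + k) % r → j ≡ k
residue-injective r s {j} {k} j<r k<r eq = begin
  j                    ≡⟨ recover j j<r ⟨
  toℕ (f⁻¹ (s + j))    ≡⟨ cong (toℕ ∘ section) (toℕ-injective (trans (toℕ-fromℕ< _) (trans eq (sym (toℕ-fromℕ< _))))) ⟩
  toℕ (f⁻¹ (s + k))    ≡⟨ recover k k<r ⟩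
  k                    ∎
  where
  open ≡-Reasoning
  section : Fin r → Fin r
  section i = fromℕ< (proj₁ (proj₂ (residue-hit r s (toℕ<n i))))

  f⁻¹ : ℕ → Fin r
  f⁻¹ x = section (fromℕ< (m%n<n x r))

  residue-section : ∀ i → (s + toℕ (section i)) % r ≡ toℕ i
  residue-section i = let _ , k<r , eq = residue-hit r s (toℕ<n i) in
    trans (cong (λ k → (s + k) % r) (toℕ-fromℕ< k<r)) eq

  section-injective : ∀ {i j} → section i ≡ section j → i ≡ j
  section-injective {i} {j} eq = toℕ-injective
    (trans (sym (residue-section i)) (trans (cong (λ k → (s + toℕ k) % r) eq) (residue-section j)))

  recover : ∀ j → j < r → toℕ (f⁻¹ (s + j)) ≡ j
  recover j j<r with injective⇒surjective section-injective (fromℕ< j<r)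
  ... | i , eq = trans (cong (toℕ ∘ section) (toℕ-injective (begin
      toℕ (fromℕ< (m%n<n (s + j) r))  ≡⟨ toℕ-fromℕ< _ ⟩
      (s + j) % r                     ≡⟨ cong (λ x → (s + x) % r) section-i≡j ⟨
      (s + toℕ (section i)) % r       ≡⟨ residue-section i ⟩
      toℕ i                           ∎))) section-i≡j
    where
    section-i≡j : toℕ (section i) ≡ j
    section-i≡j = trans (cong toℕ eq) (toℕ-fromℕ< j<r)

greatest : ∀ {P : ℕ → Set} → (∀ t → Dec (P t)) → ∀ b → (∀ t → P t → t ≤ b) → ∃ P →
           ∃ λ W → P W × (∀ t → P t → t ≤ W)
greatest P? b bound (t , Pt) with P? b
... | yes Pb = b , Pb , bound
greatest {P} P? zero bound (t , Pt) | no ¬P0 = contradiction (subst P (n≤0⇒n≡0 (bound t Pt)) Pt) ¬P0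
greatest {P} P? (suc b) bound (t , Pt) | no ¬Pb = greatest P? b bound′ (t , Pt)
  where
  bound′ : ∀ s → P s → s ≤ b
  bound′ s Ps = s≤s⁻¹ (≤∧≢⇒< (bound s Ps) λ { refl → ¬Pb Ps })

-- Finite graphs: deciding colourability and bounding the number of colours.

record FiniteGraph (G : Graph) : Set where
  field
    size   : ℕ
    enum   : V G ↔ Fin size
    adj?   : ∀ u v → Dec (Adj G u v)
    irrefl : ∀ u → ¬ Adj G u u
    adj-sym : ∀ u v → Adj G u v → Adj G v u

  open Inverse enum using (to; from; strictlyInverseˡ; strictlyInverseʳ) public

  _≟ⱽ_ : DecidableEquality (V G)
  _≟ⱽ_ = via-injection (↔⇒↣ enum) _≟ᶠ_

  ∀? : ∀ {P : V G → Set} → (∀ v → Dec (P v)) → Dec (∀ v → P v)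
  ∀? {P} P? = map′ (λ f v → subst P (strictlyInverseʳ v) (f (to v))) (λ f i → f (from i))
                   (all? (λ i → P? (from i)))

  ∃? : ∀ {P : V G → Set} → (∀ v → Dec (P v)) → Dec (Σ (V G) P)
  ∃? {P} P? = map′ (λ (i , p) → from i , p) (λ (v , p) → to v , subst P (sym (strictlyInverseʳ v)) p)
                   (any? (λ i → P? (from i)))

finite-K : ∀ m → FiniteGraph (K m)
finite-K m = record
  { size = m ; enum = ↔-id _ ; adj? = λ u v → ¬? (u ≟ᶠ v) ; irrefl = λ u u≢u → u≢u refl
  ; adj-sym = λ u v → ≢-sym }

finite-□ : ∀ {G H} → FiniteGraph G → FiniteGraph H → FiniteGraph (G □ H)
finite-□ {G} {H} FG FH = record
  { size   = FG.size * FH.size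
  ; enum   = ↔-sym *↔× ↔-∘ (FG.enum ×-↔ FH.enum)
  ; adj?   = λ { (u₁ , v₁) (u₂ , v₂) →
               (u₁ FG.≟ⱽ u₂ ×-dec FH.adj? v₁ v₂) ⊎-dec (v₁ FH.≟ⱽ v₂ ×-dec FG.adj? u₁ u₂) }
  ; irrefl = λ { (u , v) (inj₁ (_ , e)) → FH.irrefl v e ; (u , v) (inj₂ (_ , e)) → FG.irrefl u e }
  ; adj-sym = λ { (u , v) (u′ , v′) (inj₁ (eq , e)) → inj₁ (sym eq , FH.adj-sym v v′ e)
                ; (u , v) (u′ , v′) (inj₂ (eq , e)) → inj₂ (sym eq , FG.adj-sym u u′ e) }
  }
  where
  module FG = FiniteGraph FG
  module FH = FiniteGraph FH

finite-^□ : ∀ {G} → FiniteGraph G → ∀ k → FiniteGraph (G ^□ k)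
finite-^□ F zero          = finite-K 1
finite-^□ F (suc zero)    = F
finite-^□ F (suc (suc k)) = finite-□ (finite-^□ F (suc k)) F

module _ {G : Graph} (F : FiniteGraph G) where
  open FiniteGraph F

  IsIntervalColoring-resp : ∀ {t c d} → (∀ u v → Adj G u v → c u v ≡ d u v) →
                            IsIntervalColoring G t c → IsIntervalColoring G t d
  IsIntervalColoring-resp {t} {c} {d} c≗d C = record
    { symm     = λ u v e → trans (sym (c≗d u v e)) (trans (symm u v e) (c≗d v u (adj-sym u v e)))
    ; range    = λ u v e → subst (λ x → 1 ≤ x × x ≤ t) (c≗d u v e) (range u v e)
    ; allUsed  = λ i 1≤i i≤t → let u , v , e , eq = allUsed i 1≤i i≤t in
                 u , v , e , trans (sym (c≗d u v e)) eq
    ; proper   = λ v u u′ e e′ eq → proper v u u′ e e′ (trans (c≗d v u e) (trans eq (sym (c≗d v u′ e′))))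
    ; interval = λ v u u′ e e′ j l h →
                 let u″ , e″ , eq = interval v u u′ e e′ j (subst (_≤ j) (sym (c≗d v u e)) l)
                                                           (subst (j ≤_) (sym (c≗d v u′ e′)) h)
                 in u″ , e″ , trans (sym (c≗d v u″ e″)) eq
    }
    where open IsIntervalColoring C

  -- `allUsed` and `interval` quantify over all of ℕ. Taking their upper bounds, `i ≤ t` and
  -- `j ≤ c v u′`, as the first hypothesis turns both into bounded searches.
  isIntervalColoring? : ∀ t c → Dec (IsIntervalColoring G t c)
  isIntervalColoring? t c = map′
    (λ (s , r , a , p , i) → record
      { symm = s ; range = r ; allUsed = λ i 1≤i i≤t → a i (s≤s i≤t) 1≤i
      ; proper = p ; interval = λ v u u′ e e′ j l h → i v u u′ e e′ j (s≤s h) l })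
    (λ C → let open IsIntervalColoring C in
      symm , range , (λ i i≤t 1≤i → allUsed i 1≤i (s≤s⁻¹ i≤t)) , proper ,
      (λ v u u′ e e′ j h l → interval v u u′ e e′ j l (s≤s⁻¹ h)))
    (     (∀? λ u → ∀? λ v → adj? u v →-dec c u v ≟ c v u)
    ×-dec (∀? λ u → ∀? λ v → adj? u v →-dec (1 ≤? c u v ×-dec c u v ≤? t))
    ×-dec ∀<? (λ i → 1 ≤? i →-dec (∃? λ u → ∃? λ v → adj? u v ×-dec c u v ≟ i)) (suc t)
    ×-dec (∀? λ v → ∀? λ u → ∀? λ u′ → adj? v u →-dec adj? v u′ →-dec c v u ≟ c v u′ →-dec u ≟ⱽ u′)
    ×-dec (∀? λ v → ∀? λ u → ∀? λ u′ → adj? v u →-dec adj? v u′ →-dec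
             ∀<? (λ j → c v u ≤? j →-dec (∃? λ u″ → adj? v u″ ×-dec c v u″ ≟ j)) (suc (c v u′))))

  -- Colours on non-adjacent pairs are irrelevant, so every t-colouring may be
  -- truncated at t and then lies in a finite function space.
  hasIntervalColoring? : ∀ t → Dec (HasIntervalColoring G t)
  hasIntervalColoring? t = map′ (λ (k , C) → decode k , C) encode
                                (any? (λ k → isIntervalColoring? t (decode k)))
    where
    -- An index codes a `size` by `size` table with entries at most `t`, row by row.
    decode : Fin ((suc t ^ size) ^ size) → V G → V G → ℕ
    decode k u v = toℕ (finToFun (finToFun k (to u)) (to v))

    truncated : (V G → V G → ℕ) → Fin size → Fin size → Fin (suc t)
    truncated c i j = fromℕ< (s≤s (m⊓n≤n (c (from i) (from j)) t))

    encode : HasIntervalColoring G t → ∃ λ k → IsIntervalColoring G t (decode k)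
    encode (c , C) = code , IsIntervalColoring-resp (λ u v e → sym (decode-code u v e)) C
      where
      code = funToFin λ i → funToFin (truncated c i)

      decode-code : ∀ u v → Adj G u v → decode code u v ≡ c u v
      decode-code u v e = begin
        toℕ (finToFun (finToFun code (to u)) (to v))
          ≡⟨ cong (λ k → toℕ (finToFun k (to v))) (finToFun-funToFin (λ i → funToFin (truncated c i)) (to u)) ⟩
        toℕ (finToFun (funToFin (truncated c (to u))) (to v))
          ≡⟨ cong toℕ (finToFun-funToFin (truncated c (to u)) (to v)) ⟩
        toℕ (truncated c (to u) (to v))
          ≡⟨ toℕ-fromℕ< _ ⟩
        c (from (to u)) (from (to v)) ⊓ t
          ≡⟨ cong₂ (λ x y → c x y ⊓ t) (strictlyInverseʳ u) (strictlyInverseʳ v) ⟩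
        c u v ⊓ t
          ≡⟨ m≤n⇒m⊓n≡m (proj₂ (IsIntervalColoring.range C u v e)) ⟩
        c u v ∎
        where open ≡-Reasoning

  -- Choose for each colour an ordered pair of vertices carrying it. The pair determines the colour,
  -- so distinct colours get distinct pairs.
  colours≤size² : ∀ t → HasIntervalColoring G t → t ≤ size * size
  colours≤size² t (c , C) = injective⇒≤ {f = edge} λ {i} {j} eq →
    toℕ-injective (suc-injective (trans (sym (edge-colour i)) (trans (cong colourAt eq) (edge-colour j))))
    where
    module * = Inverse (*↔× {size} {size})
    open IsIntervalColoring C

    colourAt : Fin (size * size) → ℕ
    colourAt k = let i , j = *.to k in c (from i) (from j)

    edge : Fin t → Fin (size * size)
    edge i = let u , v , _ = allUsed (suc (toℕ i)) (s≤s z≤n) (toℕ<n i) in *.from (to u , to v)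

    edge-colour : ∀ i → colourAt (edge i) ≡ suc (toℕ i)
    edge-colour i with allUsed (suc (toℕ i)) (s≤s z≤n) (toℕ<n i)
    ... | u , v , _ , eq = trans (cong (λ (i , j) → c (from i) (from j)) (*.strictlyInverseˡ (to u , to v)))
                          (trans (cong₂ c (strictlyInverseʳ u) (strictlyInverseʳ v)) eq)

  greatestColors : ∀ {t} → HasIntervalColoring G t → ∃ λ W → IsGreatestColors G W × t ≤ W
  greatestColors {t} C with greatest hasIntervalColoring? _ colours≤size² (t , C)
  ... | W , CW , max = W , (CW , max) , max t C

-- Regular colourings and their reduction modulo the degree.

-- An interval t-colouring, with colours 0 , … , t ∸ 1, in which every vertex v
-- sees each of the colours start v , … , start v + (r ∸ 1) exactly once.
record Regular (G : Graph) (r t : ℕ) : Set where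
  field
    colour   : V G → V G → ℕ
    start    : V G → ℕ
    symm     : ∀ u v → Adj G u v → colour u v ≡ colour v u
    hit      : ∀ v {j} → j < r → Σ (V G) λ u → Adj G v u × colour v u ≡ start v + j
    spectrum : ∀ v u → Adj G v u → ∃ λ j → j < r × colour v u ≡ start v + j
    proper   : ∀ v u u′ → Adj G v u → Adj G v u′ → colour v u ≡ colour v u′ → u ≡ u′
    bounded  : ∀ v → start v + r ≤ t
    first    : Σ (V G) λ v → start v ≡ 0
    last     : Σ (V G) λ v → start v + r ≡ t
    covered  : ∀ {i} → i < t → Σ (V G) λ v → ∃ λ j → j < r × start v + j ≡ i

module _ {G : Graph} {r t : ℕ} (R : Regular G r t) where
  open Regular R

  hasIntervalColoring : HasIntervalColoring G t
  -- Regular colours count from 0, interval colours from 1.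
  hasIntervalColoring = (λ u v → suc (colour u v)) , record
    { symm     = λ u v e → cong suc (symm u v e)
    ; range    = λ u v e → let j , j<r , eq = spectrum u v e in
                 s≤s z≤n , subst (_< t) (sym eq) (<-≤-trans (+-monoʳ-< (start u) j<r) (bounded u))
    ; allUsed  = λ { (suc i) _ i<t → let v , j , j<r , eq = covered i<t
                                         u , e , eq′ = hit v j<r
                                     in v , u , e , cong suc (trans eq′ eq) }
    ; proper   = λ v u u′ e e′ eq → proper v u u′ e e′ (suc-injective eq)
    ; interval = interval
    }
    where
    interval : ∀ v u u′ → Adj G v u → Adj G v u′ → ∀ j → suc (colour v u) ≤ j → j ≤ suc (colour v u′) →
               Σ (V G) λ u″ → Adj G v u″ × suc (colour v u″) ≡ j
    interval v u u′ e e′ (suc j) (s≤s l) (s≤s h) with spectrum v u e | spectrum v u′ e′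
    ... | k , _ , eq | k′ , k′<r , eq′ =
      let u″ , e″ , eq″ = hit v (≤-<-trans j∸s≤k′ k′<r)
      in u″ , e″ , cong suc (trans eq″ s+[j∸s]≡j)
      where
      s = start v
      s+[j∸s]≡j : s + (j ∸ s) ≡ j
      s+[j∸s]≡j = m+[n∸m]≡n (≤-trans (m≤m+n s k) (subst (_≤ j) eq l))
      j∸s≤k′ : j ∸ s ≤ k′
      j∸s≤k′ = m≤n+o⇒m∸n≤o j s (subst (j ≤_) eq′ h)

  -- `R` serves to exhibit `r` distinct neighbours of one vertex; any interval colouring must give
  -- them distinct colours among 1, ..., `s`.
  degree≤colours : ∀ s → HasIntervalColoring G s → r ≤ s
  degree≤colours s (c , C) = injective⇒≤ {f = λ i → fromℕ< (pred-c<s i)} λ {i} {i′} eq →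
    neighbour-injective i i′ (pred-injective (fromℕ<-injective _ _ (pred-c<s i) (pred-c<s i′) eq))
    where
    module C = IsIntervalColoring C

    v = proj₁ first

    nbr : Fin r → V G
    nbr i = proj₁ (hit v (toℕ<n i))

    adj : ∀ i → Adj G v (nbr i)
    adj i = proj₁ (proj₂ (hit v (toℕ<n i)))

    -- `pred` is injective only on positive numbers, so positivity of the colours is supplied here.
    instance
      c-nonZero : ∀ {i} → NonZero (c v (nbr i))
      c-nonZero {i} = ℕ.>-nonZero (proj₁ (C.range v (nbr i) (adj i)))

    pred-c<s : ∀ i → pred (c v (nbr i)) < s
    pred-c<s i = subst (_≤ s) (sym (suc-pred (c v (nbr i)))) (proj₂ (C.range v (nbr i) (adj i)))

    neighbour-injective : ∀ i i′ → c v (nbr i) ≡ c v (nbr i′) → i ≡ i′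
    neighbour-injective i i′ eq = toℕ-injective (+-cancelˡ-≡ (start v) _ _
      (trans (sym (colour-nbr i)) (trans (cong (colour v) nbr≡) (colour-nbr i′))))
      where
      colour-nbr : ∀ i → colour v (nbr i) ≡ start v + toℕ i
      colour-nbr i = proj₂ (proj₂ (hit v (toℕ<n i)))
      nbr≡ = C.proper v _ _ (adj i) (adj i′) eq

  -- Modulo r, the r consecutive colours at a vertex become all the residues.
  reduced : .{{_ : NonZero r}} → Regular G r r
  reduced = record
    { colour   = λ u v → colour u v % r
    ; start    = λ _ → 0
    ; symm     = λ u v e → cong (_% r) (symm u v e)
    ; hit      = hit-reduced
    ; spectrum = λ v u _ → colour v u % r , m%n<n (colour v u) r , refl
    ; proper   = λ v u u′ e e′ eq → proper v u u′ e e′ (reduced-injective v u u′ e e′ eq)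
    ; bounded  = λ _ → ≤-refl
    ; first    = proj₁ first , refl
    ; last     = proj₁ first , refl
    ; covered  = λ {i} i<r → proj₁ first , i , i<r , refl
    }
    where
    hit-reduced : ∀ v {j} → j < r → Σ (V G) λ u → Adj G v u × colour v u % r ≡ j
    hit-reduced v {j} j<r with residue-hit r (start v) j<r
    ... | k , k<r , eq with hit v k<r
    ...   | u , e , eq′ = u , e , trans (cong (_% r) eq′) eq

    reduced-injective : ∀ v u u′ → Adj G v u → Adj G v u′ → colour v u % r ≡ colour v u′ % r →
                        colour v u ≡ colour v u′
    reduced-injective v u u′ e e′ eq with spectrum v u e | spectrum v u′ e′
    ... | j , j<r , eq₁ | k , k<r , eq₂ = trans eq₁ (trans (cong (start v +_) j≡k) (sym eq₂))
      where
      j≡k = residue-injective r (start v) j<r k<r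
              (trans (cong (_% r) (sym eq₁)) (trans eq (cong (_% r) eq₂)))

-- Cartesian products and powers.

module _ {G H : Graph} (FG : FiniteGraph G) (FH : FiniteGraph H) {r t r′ t′ : ℕ}
         (R : Regular G r t) (R′ : Regular H r′ t′) where
  private
    module FG = FiniteGraph FG
    module FH = FiniteGraph FH
    module R  = Regular R
    module R′ = Regular R′

  -- At (u , v) the G-edges use the r colours from start u + start v on and the
  -- H-edges the r′ colours right above them.
  regular-□ : Regular (G □ H) (r + r′) (t + t′)
  regular-□ = record
    { colour   = colour
    ; start    = start
    ; symm     = symm
    ; hit      = hit
    ; spectrum = spectrum
    ; proper   = proper
    ; bounded  = λ (u , v) → subst (_≤ t + t′) (interchange (R.start u) r (R′.start v) r′)
                                   (+-mono-≤ (R.bounded u) (R′.bounded v))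
    ; first    = let u , eq = R.first ; v , eq′ = R′.first in (u , v) , cong₂ _+_ eq eq′
    ; last     = let u , eq = R.last ; v , eq′ = R′.last in
                 (u , v) , trans (sym (interchange (R.start u) r (R′.start v) r′)) (cong₂ _+_ eq eq′)
    ; covered  = covered
    }
    where
    interchange : ∀ a r b r′ → a + r + (b + r′) ≡ a + b + (r + r′)
    interchange = solve-∀

    start : V (G □ H) → ℕ
    start (u , v) = R.start u + R′.start v

    -- Since `G` has no loops, an edge of the product joins equal first coordinates exactly when it
    -- is an `H`-edge, so this one comparison chooses the formula.
    select : ∀ {u u′} → Dec (u ≡ u′) → V H → V H → ℕ
    select {u}      (yes _) v v′ = R′.colour v v′ + (R.start u + r)
    select {u} {u′} (no  _) v v′ = R.colour u u′ + R′.start v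

    colour : V (G □ H) → V (G □ H) → ℕ
    colour (u , v) (u′ , v′) = select (u FG.≟ⱽ u′) v v′

    colour-H : ∀ u v v′ → colour (u , v) (u , v′) ≡ R′.colour v v′ + (R.start u + r)
    colour-H u v v′ with u FG.≟ⱽ u
    ... | yes _   = refl
    ... | no  u≢u = contradiction refl u≢u

    colour-G : ∀ u u′ v v′ → Adj G u u′ → colour (u , v) (u′ , v′) ≡ R.colour u u′ + R′.start v
    colour-G u u′ v v′ e with u FG.≟ⱽ u′
    ... | yes refl = contradiction e (FG.irrefl u)
    ... | no  _    = refl

    -- The summand added to a factor's colour depends only on the coordinate that the two ends
    -- share.
    symm : ∀ x y → Adj (G □ H) x y → colour x y ≡ colour y x
    symm (u , v) (.u , v′) (inj₁ (refl , e)) =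
      trans (colour-H u v v′) (trans (cong (_+ (R.start u + r)) (R′.symm v v′ e)) (sym (colour-H u v′ v)))
    symm (u , v) (u′ , .v) (inj₂ (refl , e)) =
      trans (colour-G u u′ v v e)
            (trans (cong (_+ R′.start v) (R.symm u u′ e)) (sym (colour-G u′ u v v (FG.adj-sym u u′ e))))

    shift-G : ∀ a j b → a + j + b ≡ a + b + j
    shift-G = solve-∀

    shift-H : ∀ b k a r → b + k + (a + r) ≡ a + b + (r + k)
    shift-H = solve-∀

    hit : ∀ x {j} → j < r + r′ → Σ (V (G □ H)) λ y → Adj (G □ H) x y × colour x y ≡ start x + j
    hit (u , v) {j} j<r+r′ with below⊎above r j<r+r′
    ... | inj₁ j<r with R.hit u j<r
    ...   | u′ , e , eq = (u′ , v) , inj₂ (refl , e) ,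
            trans (colour-G u u′ v v e)
                  (trans (cong (_+ R′.start v) eq) (shift-G (R.start u) j (R′.start v)))
    hit (u , v) _ | inj₂ (k , k<r′ , refl) with R′.hit v k<r′
    ...   | v′ , e , eq = (u , v′) , inj₁ (refl , e) ,
            trans (colour-H u v v′)
                  (trans (cong (_+ (R.start u + r)) eq) (shift-H (R′.start v) k (R.start u) r))

    spectrum : ∀ x y → Adj (G □ H) x y → ∃ λ j → j < r + r′ × colour x y ≡ start x + j
    spectrum (u , v) (.u , v′) (inj₁ (refl , e)) with R′.spectrum v v′ e
    ... | k , k<r′ , eq = r + k , +-monoʳ-< r k<r′ ,
      trans (colour-H u v v′)
            (trans (cong (_+ (R.start u + r)) eq) (shift-H (R′.start v) k (R.start u) r))
    spectrum (u , v) (u′ , .v) (inj₂ (refl , e)) with R.spectrum u u′ e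
    ... | j , j<r , eq = j , <-≤-trans j<r (m≤m+n r r′) ,
      trans (colour-G u u′ v v e)
            (trans (cong (_+ R′.start v) eq) (shift-G (R.start u) j (R′.start v)))

    -- Relative to `start (u , v)`, a `G`-edge has offset below `r` and an `H`-edge has offset at
    -- least `r`.
    G≢H : ∀ u v u′ v′ → Adj G u u′ → Adj H v v′ → colour (u , v) (u′ , v) ≢ colour (u , v) (u , v′)
    G≢H u v u′ v′ e e′ eq with R.spectrum u u′ e | R′.spectrum v v′ e′
    ... | j , j<r , eq₁ | k , _ , eq₂ = m+n≮m r k (subst (_< r) j≡r+k j<r)
      where
      open ≡-Reasoning
      j≡r+k : j ≡ r + k
      j≡r+k = +-cancelˡ-≡ (R.start u + R′.start v) _ _ (begin
        R.start u + R′.start v + j            ≡⟨ shift-G (R.start u) j (R′.start v) ⟨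
        R.start u + j + R′.start v            ≡⟨ cong (_+ R′.start v) eq₁ ⟨
        R.colour u u′ + R′.start v            ≡⟨ colour-G u u′ v v e ⟨
        colour (u , v) (u′ , v)               ≡⟨ eq ⟩
        colour (u , v) (u , v′)               ≡⟨ colour-H u v v′ ⟩
        R′.colour v v′ + (R.start u + r)      ≡⟨ cong (_+ (R.start u + r)) eq₂ ⟩
        R′.start v + k + (R.start u + r)      ≡⟨ shift-H (R′.start v) k (R.start u) r ⟩
        R.start u + R′.start v + (r + k)      ∎)

    proper : ∀ x y y′ → Adj (G □ H) x y → Adj (G □ H) x y′ → colour x y ≡ colour x y′ → y ≡ y′
    proper (u , v) (.u , v₁) (.u , v₂) (inj₁ (refl , e₁)) (inj₁ (refl , e₂)) eq =
      cong (u ,_) (R′.proper v v₁ v₂ e₁ e₂ (+-cancelʳ-≡ (R.start u + r) _ _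
        (trans (sym (colour-H u v v₁)) (trans eq (colour-H u v v₂)))))
    proper (u , v) (u₁ , .v) (u₂ , .v) (inj₂ (refl , e₁)) (inj₂ (refl , e₂)) eq =
      cong (_, v) (R.proper u u₁ u₂ e₁ e₂ (+-cancelʳ-≡ (R′.start v) _ _
        (trans (sym (colour-G u u₁ v v e₁)) (trans eq (colour-G u u₂ v v e₂)))))
    proper (u , v) (.u , v₁) (u₂ , .v) (inj₁ (refl , e₁)) (inj₂ (refl , e₂)) eq =
      contradiction (sym eq) (G≢H u v u₂ v₁ e₂ e₁)
    proper (u , v) (u₁ , .v) (.u , v₂) (inj₂ (refl , e₁)) (inj₁ (refl , e₂)) eq =
      contradiction eq (G≢H u v u₁ v₂ e₁ e₂)

    -- Colours below `t` occur on `G`-edges over a vertex of `H` with start 0. The others occur on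
    -- `H`-edges over a vertex of `G` whose colours end just below `t`.
    covered : ∀ {i} → i < t + t′ → Σ (V (G □ H)) λ x → ∃ λ j → j < r + r′ × start x + j ≡ i
    covered i<t+t′ with below⊎above t i<t+t′
    ... | inj₁ i<t with R.covered i<t | R′.first
    ...   | u , j , j<r , eq | v , eq′ =
            (u , v) , j , <-≤-trans j<r (m≤m+n r r′) ,
            trans (cong (_+ j) (trans (cong (R.start u +_) eq′) (+-identityʳ _))) eq
    covered _ | inj₂ (i , i<t′ , refl) with R.last | R′.covered i<t′
    ...   | u , eq | v , k , k<r′ , eq′ =
            (u , v) , r + k , +-monoʳ-< r k<r′ ,
            trans (sym (interchange (R.start u) r (R′.start v) k)) (cong₂ _+_ eq eq′)

regular-^□ : ∀ {G r t} → FiniteGraph G → Regular G r t → ∀ k → Regular (G ^□ suc k) (suc k * r) (suc k * t)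
regular-^□ {G} {r} {t} F R zero = subst₂ (Regular G) (sym (*-identityˡ r)) (sym (*-identityˡ t)) R
regular-^□ {G} {r} {t} F R (suc k) = subst₂ (Regular (G ^□ suc (suc k))) (+-comm (suc k * r) r) (+-comm (suc k * t) t)
  (regular-□ (finite-^□ F (suc k)) F (regular-^□ F R k) R)

-- Complete graphs on arbitrary vertex sets.

-- `K m` is definitionally `Complete (Fin m)`. With a free vertex set, colourings can be built on
-- disjoint unions and moved to `Fin` afterwards.
Complete : Set → Graph
Complete A = record { V = A ; Adj = _≢_ }

regular-↔ : ∀ {A B : Set} {r t} → A ↔ B → Regular (Complete A) r t → Regular (Complete B) r t
regular-↔ A↔B R = record
  { colour   = λ u v → colour (from u) (from v)
  ; start    = λ v → start (from v)
  ; symm     = λ u v u≢v → symm (from u) (from v) (from-≢ u≢v)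
  ; hit      = λ v j<r → let u , v≢u , eq = hit (from v) j<r in
               to u , (λ v≡to-u → v≢u (trans (cong from v≡to-u) (strictlyInverseʳ u))) ,
               trans (cong (colour (from v)) (strictlyInverseʳ u)) eq
  ; spectrum = λ v u v≢u → spectrum (from v) (from u) (from-≢ v≢u)
  ; proper   = λ v u u′ v≢u v≢u′ eq →
               from-injective (proper (from v) (from u) (from u′) (from-≢ v≢u) (from-≢ v≢u′) eq)
  ; bounded  = λ v → bounded (from v)
  ; first    = let v , eq = first in to v , trans (cong start (strictlyInverseʳ v)) eq
  ; last     = let v , eq = last in to v , trans (cong (λ v → start v + _) (strictlyInverseʳ v)) eq
  ; covered  = λ i<t → let v , j , j<r , eq = covered i<t in
               to v , j , j<r , trans (cong (λ v → start v + j) (strictlyInverseʳ v)) eq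
  }
  where
  open Regular R
  open Inverse A↔B using (to; from; strictlyInverseʳ)

  from-injective : ∀ {u v} → from u ≡ from v → u ≡ v
  from-injective = Injection.injective (↔⇒↣ (↔-sym A↔B))

  from-≢ : ∀ {u v} → u ≢ v → from u ≢ from v
  from-≢ u≢v = u≢v ∘ from-injective

-- A vertex of a complete graph on r + 1 vertices has only r edges, so if it
-- sees r distinct colours then it sees them once each and sees no others.
module _ {A : Set} {r : ℕ} (enum : A ↔ Fin (suc r)) (colour : A → A → ℕ) (start : A → ℕ)
         (hit : ∀ v {j} → j < r → Σ A λ u → v ≢ u × colour v u ≡ start v + j) where
  private
    open Inverse enum using (to)

    to-injective : ∀ {u v} → to u ≡ to v → u ≡ v
    to-injective = Injection.injective (↔⇒↣ enum)

    nbr : A → Fin r → A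
    nbr v j = proj₁ (hit v (toℕ<n j))

    v≢nbr : ∀ v j → v ≢ nbr v j
    v≢nbr v j = proj₁ (proj₂ (hit v (toℕ<n j)))

    colour-nbr : ∀ v j → colour v (nbr v j) ≡ start v + toℕ j
    colour-nbr v j = proj₂ (proj₂ (hit v (toℕ<n j)))

    vertex : A → Fin (suc r) → A
    vertex v zero    = v
    vertex v (suc j) = nbr v j

    vertex-injective : ∀ v {i j} → to (vertex v i) ≡ to (vertex v j) → i ≡ j
    vertex-injective v {zero}  {zero}  eq = refl
    vertex-injective v {zero}  {suc j} eq = contradiction (to-injective eq) (v≢nbr v j)
    vertex-injective v {suc i} {zero}  eq = contradiction (sym (to-injective eq)) (v≢nbr v i)
    vertex-injective v {suc i} {suc j} eq = cong suc (toℕ-injective (+-cancelˡ-≡ (start v) _ _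
      (trans (sym (colour-nbr v i)) (trans (cong (colour v) (to-injective eq)) (colour-nbr v j)))))

    -- `v` and its `r` chosen neighbours are `suc r` distinct vertices, so they exhaust the graph.
    nbr-surjective : ∀ v u → v ≢ u → ∃ λ j → nbr v j ≡ u
    nbr-surjective v u v≢u with injective⇒surjective (vertex-injective v) (to u)
    ... | zero  , eq = contradiction (to-injective eq) v≢u
    ... | suc j , eq = j , to-injective eq

  hits⇒spectrum : ∀ v u → v ≢ u → ∃ λ j → j < r × colour v u ≡ start v + j
  hits⇒spectrum v u v≢u with nbr-surjective v u v≢u
  ... | j , refl = toℕ j , toℕ<n j , colour-nbr v j

  hits⇒proper : ∀ v u u′ → v ≢ u → v ≢ u′ → colour v u ≡ colour v u′ → u ≡ u′
  hits⇒proper v u u′ v≢u v≢u′ eq with nbr-surjective v u v≢u | nbr-surjective v u′ v≢u′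
  ... | i , refl | j , refl = cong (nbr v) (toℕ-injective (+-cancelˡ-≡ (start v) _ _
    (trans (sym (colour-nbr v i)) (trans eq (colour-nbr v j)))))

-- Doubling a complete graph.

Double : ℕ → Set
Double M = Fin M ⊎ Fin M

-- Two copies of a colouring, the second shifted up by 2r + 1.  The edge from a
-- vertex i of one copy to j of the other repeats the colour of ij, shifted up
-- by r + 1; the edge joining the two copies of i fills the remaining gap.
module Doubling {r t : ℕ} (R : Regular (K (suc r)) r t) where
  private
    module R = Regular R

    A : Set
    A = Double (suc r)

    bridge : ∀ {i j : Fin (suc r)} → Dec (i ≡ j) → ℕ
    bridge {i}     (yes _) = R.start i + r
    bridge {i} {j} (no  _) = R.colour i j + suc r

    colour : A → A → ℕ
    colour (inj₁ i) (inj₁ j) = R.colour i j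
    colour (inj₁ i) (inj₂ j) = bridge (i ≟ᶠ j)
    colour (inj₂ i) (inj₁ j) = bridge (j ≟ᶠ i)
    colour (inj₂ i) (inj₂ j) = R.colour i j + (r + suc r)

    start : A → ℕ
    start (inj₁ i) = R.start i
    start (inj₂ i) = R.start i + r

    bridge-≡ : ∀ i → bridge (i ≟ᶠ i) ≡ R.start i + r
    bridge-≡ i with i ≟ᶠ i
    ... | yes _   = refl
    ... | no  i≢i = contradiction refl i≢i

    bridge-≢ : ∀ {i j} → i ≢ j → bridge (i ≟ᶠ j) ≡ R.colour i j + suc r
    bridge-≢ {i} {j} i≢j with i ≟ᶠ j
    ... | yes i≡j = contradiction i≡j i≢j
    ... | no  _   = refl

    symm : ∀ u v → u ≢ v → colour u v ≡ colour v u
    symm (inj₁ i) (inj₁ j) u≢v = R.symm i j (u≢v ∘ cong inj₁)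
    symm (inj₁ i) (inj₂ j) u≢v = refl
    symm (inj₂ i) (inj₁ j) u≢v = refl
    symm (inj₂ i) (inj₂ j) u≢v = cong (_+ (r + suc r)) (R.symm i j (u≢v ∘ cong inj₂))

    -- Let s be `R.start i`. In the first copy, edges inside the copy fill [s, s + r), the edge to
    -- the twin has s + r, and the other crossing edges fill [s + r + 1, s + 2r + 1). In the second
    -- copy the twin edge comes first with s + r, then the same crossing range, then the inside
    -- edges on [s + 2r + 1, s + 3r + 1).
    hit : ∀ v {j} → j < r + suc r → Σ A λ u → v ≢ u × colour v u ≡ start v + j
    hit (inj₁ i) j<r′ with below⊎above r j<r′
    hit (inj₁ i) _ | inj₁ j<r with R.hit i j<r
    ... | i′ , i≢i′ , eq = inj₁ i′ , i≢i′ ∘ inj₁-injective , eq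
    hit (inj₁ i) _ | inj₂ (zero , _ , refl) =
      inj₂ i , (λ ()) , trans (bridge-≡ i) (cong (R.start i +_) (sym (+-identityʳ r)))
    hit (inj₁ i) _ | inj₂ (suc k , s≤s k<r , refl) with R.hit i k<r
    ... | i′ , i≢i′ , eq = inj₂ i′ , (λ ()) ,
      trans (bridge-≢ i≢i′) (trans (cong (_+ suc r) eq) (arith (R.start i) k r))
      where
      arith : ∀ a k r → a + k + suc r ≡ a + (r + suc k)
      arith = solve-∀
    hit (inj₂ i) {zero} _ = inj₁ i , (λ ()) , trans (bridge-≡ i) (sym (+-identityʳ _))
    hit (inj₂ i) {suc j} j<r′ with below⊎above r (s≤s⁻¹ (subst (suc j <_) (+-suc r r) j<r′))
    hit (inj₂ i) _ | inj₁ j<r with R.hit i j<r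
    ... | i′ , i≢i′ , eq = inj₁ i′ , (λ ()) ,
      -- `bridge` takes its end in the first copy first, so the colour of this edge has to be turned
      -- round with `R.symm`.
      trans (bridge-≢ (≢-sym i≢i′)) (trans (cong (_+ suc r) (trans (R.symm i′ i (≢-sym i≢i′)) eq)) (arith (R.start i) _ r))
      where
      arith : ∀ a k r → a + k + suc r ≡ a + r + suc k
      arith = solve-∀
    hit (inj₂ i) _ | inj₂ (l , l<r , refl) with R.hit i l<r
    ... | i′ , i≢i′ , eq = inj₂ i′ , i≢i′ ∘ inj₂-injective ,
      trans (cong (_+ (r + suc r)) eq) (arith (R.start i) l r)
      where
      arith : ∀ a l r → a + l + (r + suc r) ≡ a + r + suc (r + l)
      arith = solve-∀

    bounded : ∀ v → start v + (r + suc r) ≤ t + (r + suc r)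
    bounded (inj₁ i) = +-monoˡ-≤ _ (≤-trans (m≤m+n (R.start i) r) (R.bounded i))
    bounded (inj₂ i) = +-monoˡ-≤ _ (R.bounded i)

    -- The first copy supplies the colours below `t`. The twin of a vertex whose colours ended just
    -- below `t` now starts at `t` and supplies all the rest.
    covered : ∀ {i} → i < t + (r + suc r) → Σ A λ v → ∃ λ j → j < r + suc r × start v + j ≡ i
    covered i<t′ with below⊎above t i<t′
    ... | inj₁ i<t with R.covered i<t
    ...   | x , j , j<r , eq = inj₁ x , j , <-≤-trans j<r (m≤m+n r (suc r)) , eq
    covered _ | inj₂ (k , k<r′ , refl) = let x , eq = R.last in inj₂ x , k , k<r′ , cong (_+ k) eq

  doubled : Regular (K (suc r + suc r)) (r + suc r) (t + (r + suc r))
  doubled = regular-↔ (↔-sym +↔⊎) (record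
    { colour   = colour
    ; start    = start
    ; symm     = symm
    ; hit      = hit
    ; spectrum = hits⇒spectrum (↔-sym +↔⊎) colour start hit
    ; proper   = hits⇒proper (↔-sym +↔⊎) colour start hit
    ; bounded  = bounded
    ; first    = let x , eq = R.first in inj₁ x , eq
    ; last     = let x , eq = R.last in inj₂ x , cong (_+ (r + suc r)) eq
    ; covered  = covered
    })

open Doubling using (doubled)

-- The base colouring of a complete graph of even order.

-- Kamalian's colouring of K_{2m+2} on vertices P, Q, X i, Y i (i < m), where
-- X i starts at colour i and Y i at i + 1.  Edges inside {P, X} and inside
-- {Q, Y} avoid the band [m , 2m).  Edges between the two sides fill the band as
-- a cyclic Latin square, except that PQ gets 2m and X i – Y i the colour 2i + 1
-- (moved past the band if necessary) that the formula for X i – X j and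
-- Y i – Y j leaves free at j = i.
module Base (m : ℕ) where
  private
    A : Set
    A = Double (suc m)

    pattern P   = inj₁ zero
    pattern X i = inj₁ (suc i)
    pattern Q   = inj₂ zero
    pattern Y i = inj₂ (suc i)

    skip : ℕ → ℕ
    skip s with s <? m
    ... | yes _ = s
    ... | no  _ = s + m

    skip-low : ∀ {s} → s < m → skip s ≡ s
    skip-low {s} s<m with s <? m
    ... | yes _   = refl
    ... | no  s≮m = contradiction s<m s≮m

    skip-high : ∀ {s} → m ≤ s → skip s ≡ s + m
    skip-high {s} m≤s with s <? m
    ... | yes s<m = contradiction m≤s (<⇒≱ s<m)
    ... | no  _   = refl

    -- Off the diagonal this is m + ((j - i - 1) mod (m + 1)). The edges P - `Y j` and Q - `X i`
    -- obey the same formula if P and Q count as `X` and `Y` of index m. On the diagonal it would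
    -- give 2m, which only PQ keeps.
    cross : ℕ → ℕ → ℕ
    cross i j with <-cmp i j
    ... | tri< _ _ _ = m + (j ∸ suc i)
    ... | tri≈ _ _ _ = skip (suc (i + i))
    ... | tri> _ _ _ = m + (m ∸ (i ∸ j))

    cross-≡ : ∀ i → cross i i ≡ skip (suc (i + i))
    cross-≡ i with <-cmp i i
    ... | tri< _ i≢i _ = contradiction refl i≢i
    ... | tri≈ _ _ _   = refl
    ... | tri> _ i≢i _ = contradiction refl i≢i

    cross-below : ∀ i d → cross i (i + suc d) ≡ m + d
    cross-below i d with <-cmp i (i + suc d)
    ... | tri< _ _ _   = cong (m +_) (trans (cong (_∸ suc i) (+-suc i d)) (m+n∸m≡n i d))
    ... | tri≈ i≮ _ _  = contradiction (m<m+n i (s≤s z≤n)) i≮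
    ... | tri> i≮ _ _  = contradiction (m<m+n i (s≤s z≤n)) i≮

    -- The wrapped half of the Latin square: `j` is i + d + 1 reduced by m + 1, and `d < m` forces
    -- `j < i`.
    cross-above : ∀ i j d → d < m → i + d ≡ m + j → cross i j ≡ m + d
    cross-above i j d d<m eq = case
      where
      open ≡-Reasoning
      j<i : j < i
      j<i = +-cancelˡ-< m j i (subst (_< m + i) eq (subst (i + d <_) (+-comm i m) (+-monoʳ-< i d<m)))

      i∸j≡m∸d : i ∸ j ≡ m ∸ d
      i∸j≡m∸d = begin
        i ∸ j              ≡⟨ [m+n]∸[m+o]≡n∸o d i j ⟨
        d + i ∸ (d + j)    ≡⟨ cong₂ _∸_ (trans (+-comm d i) (trans eq (+-comm m j))) (+-comm d j) ⟩
        j + m ∸ (j + d)    ≡⟨ [m+n]∸[m+o]≡n∸o j m d ⟩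
        m ∸ d              ∎

      case : cross i j ≡ m + d
      case with <-cmp i j
      ... | tri< _ _ i≯j = contradiction j<i i≯j
      ... | tri≈ _ _ i≯j = contradiction j<i i≯j
      ... | tri> _ _ _   = cong (m +_) (trans (cong (m ∸_) i∸j≡m∸d) (m∸[m∸n]≡n (<⇒≤ d<m)))

    colour : A → A → ℕ
    -- There is no such edge; 0 is a placeholder, as it is for Q with itself.
    colour P     P     = 0
    colour P     (X i) = toℕ i
    colour P     Q     = m + m
    colour P     (Y j) = m + toℕ j
    colour (X i) P     = toℕ i
    colour (X i) (X j) = skip (suc (toℕ i + toℕ j))
    colour (X i) Q     = m + (m ∸ suc (toℕ i))
    colour (X i) (Y j) = cross (toℕ i) (toℕ j)
    colour Q     P     = m + m
    colour Q     (X i) = m + (m ∸ suc (toℕ i))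
    colour Q     Q     = 0
    colour Q     (Y j) = m + (m + suc (toℕ j))
    colour (Y j) P     = m + toℕ j
    colour (Y j) (X i) = cross (toℕ i) (toℕ j)
    colour (Y j) Q     = m + (m + suc (toℕ j))
    colour (Y i) (Y j) = skip (suc (toℕ i + toℕ j))

    start : A → ℕ
    start P     = 0
    start (X i) = toℕ i
    start Q     = m
    start (Y i) = suc (toℕ i)

    r t : ℕ
    r = m + suc m
    t = m + r

    symm : ∀ u v → u ≢ v → colour u v ≡ colour v u
    symm P     P     _ = refl
    symm P     (X i) _ = refl
    symm P     Q     _ = refl
    symm P     (Y j) _ = refl
    symm (X i) P     _ = refl
    symm (X i) (X j) _ = cong (skip ∘ suc) (+-comm (toℕ i) (toℕ j))
    symm (X i) Q     _ = refl
    symm (X i) (Y j) _ = refl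
    symm Q     P     _ = refl
    symm Q     (X i) _ = refl
    symm Q     Q     _ = refl
    symm Q     (Y j) _ = refl
    symm (Y j) P     _ = refl
    symm (Y j) (X i) _ = refl
    symm (Y j) Q     _ = refl
    symm (Y i) (Y j) _ = cong (skip ∘ suc) (+-comm (toℕ i) (toℕ j))

    Sees : A → ℕ → Set
    Sees v c = Σ A λ u → v ≢ u × colour v u ≡ c

    fin : ∀ {k} → k < m → ∃ λ (i : Fin m) → toℕ i ≡ k
    fin k<m = fromℕ< k<m , toℕ-fromℕ< k<m

    -- At j = i there is no edge inside the side, and the edge `X i` - `Y i` carries the colour
    -- instead.
    sees-pairX : ∀ i j → Sees (X i) (skip (suc (toℕ i + toℕ j)))
    sees-pairX i j with i ≟ᶠ j
    ... | yes refl = Y i , (λ ()) , cross-≡ (toℕ i)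
    ... | no  i≢j  = X j , (λ { refl → i≢j refl }) , refl

    sees-pairY : ∀ i j → Sees (Y i) (skip (suc (toℕ i + toℕ j)))
    sees-pairY i j with i ≟ᶠ j
    ... | yes refl = X i , (λ ()) , cross-≡ (toℕ i)
    ... | no  i≢j  = Y j , (λ { refl → i≢j refl }) , refl

    -- The neighbour has index i + 1 + d modulo m + 1: a `Y` without wrapping, Q at index m exactly,
    -- or a `Y` after wrapping.
    sees-bandX : ∀ i {d} → d < m → Sees (X i) (m + d)
    sees-bandX i {d} d<m with <-cmp (toℕ i + suc d) m
    ... | tri< j<m _ _ with fin j<m
    ...   | j , eq = Y j , (λ ()) , trans (cong (cross (toℕ i)) eq) (cross-below (toℕ i) d)
    sees-bandX i {d} d<m | tri≈ _ i+1+d≡m _ = Q , (λ ()) , cong (m +_) (begin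
      m ∸ suc (toℕ i)                    ≡⟨ cong (_∸ suc (toℕ i)) i+1+d≡m ⟨
      toℕ i + suc d ∸ suc (toℕ i)        ≡⟨ cong (_∸ suc (toℕ i)) (+-suc (toℕ i) d) ⟩
      toℕ i + d ∸ toℕ i                  ≡⟨ m+n∸m≡n (toℕ i) d ⟩
      d                                  ∎)
      where open ≡-Reasoning
    sees-bandX i {d} d<m | tri> _ _ m<i+1+d with fin j<m
      where
      j<m : toℕ i + d ∸ m < m
      j<m = m<n+o⇒m∸n<o (toℕ i + d) m {m} {{ℕ.>-nonZero (≤-<-trans z≤n d<m)}} (+-mono-< (toℕ<n i) d<m)
    ... | j , eq = Y j , (λ ()) , cross-above (toℕ i) (toℕ j) d d<m
      (trans (sym (m+[n∸m]≡n (s≤s⁻¹ (subst (m <_) (+-suc (toℕ i) d) m<i+1+d)))) (cong (m +_) (sym eq)))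

    -- Here the same congruence is solved for the other end, of index j - d - 1 modulo m + 1, and P
    -- plays the part of index m.
    sees-bandY : ∀ j {d} → d < m → Sees (Y j) (m + d)
    sees-bandY j {d} d<m with <-cmp d (toℕ j)
    ... | tri< d<j _ _ with fin (≤-<-trans (m∸n≤m (toℕ j) (suc d)) (toℕ<n j))
    ...   | i , eq = X i , (λ ()) ,
            trans (cong (cross (toℕ i)) (sym (trans (cong (_+ suc d) eq) (m∸n+n≡m d<j)))) (cross-below (toℕ i) d)
    sees-bandY j d<m | tri≈ _ refl _ = P , (λ ()) , refl
    sees-bandY j {d} d<m | tri> _ _ j<d with fin i<m
      where
      i<m : m + toℕ j ∸ d < m
      i<m = m<n+o⇒m∸n<o (m + toℕ j) d {m} {{ℕ.>-nonZero (≤-<-trans z≤n d<m)}}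
              (subst (m + toℕ j <_) (+-comm m d) (+-monoʳ-< m j<d))
    ... | i , eq = X i , (λ ()) , cross-above (toℕ i) (toℕ j) d d<m
      (trans (cong (_+ d) eq) (m∸n+n≡m (≤-trans (<⇒≤ d<m) (m≤m+n m (toℕ j)))))

    -- The sums i + 1 + j for j < m run through [i + 1, i + m]. `skip` cuts this interval at m and
    -- lifts the upper piece by m; the band fills the gap, which gives all of [i + 1, i + 2m].
    sees-all : ∀ {v} {i : Fin m} → (∀ j → Sees v (skip (suc (toℕ i + toℕ j)))) →
               (∀ {d} → d < m → Sees v (m + d)) →
               ∀ {k} → k < m + m → Sees v (suc (toℕ i + k))
    sees-all {v} {i} pair band {k} k<2m with suc (toℕ i + k) <? m
    ... | yes c<m with fin (≤-<-trans (m≤n+m k (suc (toℕ i))) c<m)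
    ...   | j , refl = subst (Sees v) (skip-low c<m) (pair j)
    sees-all {v} {i} pair band {k} k<2m | no c≮m with suc (toℕ i + k) <? m + m
    ... | yes c<2m = subst (Sees v) m+[c∸m]≡c (band (+-cancelˡ-< m _ _ (subst (_< m + m) (sym m+[c∸m]≡c) c<2m)))
      where m+[c∸m]≡c = m+[n∸m]≡n (≮⇒≥ c≮m)
    -- A colour of at least 2m forces k ≥ m, since i < m; then k - m is the index of the partner.
    ... | no c≮2m with below⊎above m k<2m
    ...   | inj₁ k<m = contradiction (+-mono-<-≤ (toℕ<n i) k<m) (c≮2m ∘ subst (_≤ m + m) (cong suc (+-suc (toℕ i) k)))
    ...   | inj₂ (l , l<m , refl) with fin l<m
    ...     | j , refl = subst (Sees v) (trans (skip-high m≤1+i+j) (arith (toℕ i) (toℕ j) m)) (pair j)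
      where
      arith : ∀ i j m → suc (i + j) + m ≡ suc (i + (m + j))
      arith = solve-∀
      m≤1+i+j : m ≤ suc (toℕ i + toℕ j)
      m≤1+i+j = +-cancelʳ-≤ m _ _ (subst (m + m ≤_) (sym (arith (toℕ i) (toℕ j) m)) (≮⇒≥ c≮2m))

    below⊎last : ∀ {j} → j < r → j < m + m ⊎ j ≡ m + m
    below⊎last {j} j<r = m<1+n⇒m<n∨m≡n (subst (j <_) (+-suc m m) j<r)

    -- `X i` gets its lowest colour i from P and `Y i` its highest colour 2m + 1 + i from Q; their
    -- other 2m colours come from `sees-all`. P and Q meet the two sides one after the other, with
    -- the edge PQ last at P and between the sides at Q.
    hit : ∀ v {j} → j < r → Sees v (start v + j)
    hit P j<r with below⊎above m j<r
    ... | inj₁ j<m = let i , eq = fin j<m in X i , (λ ()) , eq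
    ... | inj₂ (k , k<1+m , refl) with m<1+n⇒m<n∨m≡n k<1+m
    ...   | inj₁ k<m = let j , eq = fin k<m in Y j , (λ ()) , cong (m +_) eq
    ...   | inj₂ refl = Q , (λ ()) , refl
    hit (X i) {zero}  _   = P , (λ ()) , sym (+-identityʳ (toℕ i))
    hit (X i) {suc k} k<r = subst (Sees (X i)) (sym (+-suc (toℕ i) k))
      (sees-all (sees-pairX i) (sees-bandX i) (s≤s⁻¹ (subst (suc k <_) (+-suc m m) k<r)))
    hit Q {j} j<r with below⊎above m j<r
    ... | inj₁ j<m with fin (m∸1+j<m)
      where
      m∸1+j<m : m ∸ suc j < m
      m∸1+j<m = ∸-monoʳ-< (s≤s z≤n) j<m
    ...   | i , eq = X i , (λ ()) , cong (m +_) (begin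
            m ∸ suc (toℕ i)       ≡⟨ cong (λ x → m ∸ suc x) eq ⟩
            m ∸ suc (m ∸ suc j)   ≡⟨ cong (m ∸_) (+-∸-assoc 1 j<m) ⟨
            m ∸ (m ∸ j)           ≡⟨ m∸[m∸n]≡n (<⇒≤ j<m) ⟩
            j                     ∎)
      where open ≡-Reasoning
    hit Q _ | inj₂ (zero , _ , refl) = P , (λ ()) , cong (m +_) (sym (+-identityʳ m))
    hit Q _ | inj₂ (suc k , s≤s k<m , refl) =
      let j , eq = fin k<m in Y j , (λ ()) , cong (λ x → m + (m + suc x)) eq
    hit (Y i) j<r with below⊎last j<r
    ... | inj₁ k<2m = sees-all (sees-pairY i) (sees-bandY i) k<2m
    ... | inj₂ refl = Q , (λ ()) , arith (toℕ i) m
      where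
      arith : ∀ i m → m + (m + suc i) ≡ suc i + (m + m)
      arith = solve-∀

    bounded : ∀ v → start v + r ≤ t
    bounded P     = m≤n+m r m
    bounded (X i) = +-monoˡ-≤ r (<⇒≤ (toℕ<n i))
    bounded Q     = ≤-refl
    bounded (Y i) = +-monoˡ-≤ r (toℕ<n i)

    covered : ∀ {i} → i < t → Σ A λ v → ∃ λ j → j < r × start v + j ≡ i
    covered {i} i<t with below⊎above m i<t
    ... | inj₁ i<m              = P , i , <-≤-trans i<m (m≤m+n m (suc m)) , refl
    ... | inj₂ (j , j<r , refl) = Q , j , j<r , refl

  base : Regular (K (suc m + suc m)) (m + suc m) (m + (m + suc m))
  base = regular-↔ (↔-sym +↔⊎) (record
    { colour   = colour
    ; start    = start
    ; symm     = symm
    ; hit      = hit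
    ; spectrum = hits⇒spectrum (↔-sym +↔⊎) colour start hit
    ; proper   = hits⇒proper (↔-sym +↔⊎) colour start hit
    ; bounded  = bounded
    ; first    = P , refl
    ; last     = Q , refl
    ; covered  = covered
    })

open Base using (base)

-- Iterated doubling and the three claims.

-- Here p is `suc m`. Doubling n raises 4n by 4n: `t` gains 4n - 1 and `q` the remaining 1, so the
-- sum keeps pace. The invariant is additive to avoid truncated subtraction.
complete : ∀ m q → ∃ λ r → ∃ λ t → Regular (K (suc r)) r t ×
           suc r ≡ 2 * (suc m * 2 ^ q) × t + (2 + suc m + q) ≡ 4 * (suc m * 2 ^ q)
complete m zero = m + suc m , m + (m + suc m) , base m , arith₁ m , arith₂ m
  where
  arith₁ : ∀ m → suc m + suc m ≡ 2 * (suc m * 1)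
  arith₁ = solve-∀
  arith₂ : ∀ m → m + (m + suc m) + (2 + suc m + 0) ≡ 4 * (suc m * 1)
  arith₂ = solve-∀
complete m (suc q) with complete m q
... | r , t , R , eq₁ , eq₂ = r + suc r , t + (r + suc r) , doubled R ,
  trans (cong₂ _+_ eq₁ eq₁) (arith₁ (suc m) (2 ^ q)) ,
  (begin
    t + (r + suc r) + (2 + suc m + suc q)                     ≡⟨ arith₂ t r m q ⟩
    t + (2 + suc m + q) + (suc r + suc r)                     ≡⟨ cong₂ _+_ eq₂ (cong₂ _+_ eq₁ eq₁) ⟩
    4 * (suc m * 2 ^ q) + (2 * (suc m * 2 ^ q) + 2 * (suc m * 2 ^ q)) ≡⟨ arith₃ (suc m) (2 ^ q) ⟩
    4 * (suc m * (2 * 2 ^ q))                                 ∎)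
  where
  open ≡-Reasoning
  arith₁ : ∀ p x → 2 * (p * x) + 2 * (p * x) ≡ 2 * (p * (2 * x))
  arith₁ = solve-∀
  arith₂ : ∀ t r m q → t + (r + suc r) + (2 + suc m + suc q) ≡ t + (2 + suc m + q) + (suc r + suc r)
  arith₂ = solve-∀
  arith₃ : ∀ p x → 4 * (p * x) + (2 * (p * x) + 2 * (p * x)) ≡ 4 * (p * (2 * x))
  arith₃ = solve-∀

theorem8 : (n k p q : ℕ) → 1 ≤ n → 1 ≤ k → ¬ (2 ∣ p) → n ≡ p * 2 ^ q →
    IntervalColorable (Hyp n k)
    × (Σ ℕ λ w → IsLeastColors (Hyp n k) w × w ≡ (2 * n ∸ 1) * k)
    × (Σ ℕ λ W → IsGreatestColors (Hyp n k) W × (4 * n ∸ 2 ∸ p ∸ q) * k ≤ W)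
-- p = 0 would make n = 0.
theorem8 n (suc k) zero    q () _ _ refl
theorem8 n (suc k) (suc m) q _  _ _ refl with complete m q
-- Degree 0 is excluded by parity, so reduction modulo the degree makes sense below.
... | zero        , _ , _ , 1≡2n     , _  = contradiction (sym 1≡2n) (even≢odd n 0)
... | r@(suc r-1) , t , R , 1+r≡2n , eq =
  (suc k * r , s≤s z≤n , fewest) ,
  (suc k * r , (fewest , degree≤colours product) ,
   trans (*-comm (suc k) r) (cong (λ N → (N ∸ 1) * suc k) 1+r≡2n)) ,
  (let W , isGreatest , kt≤W = greatestColors (finite-^□ (finite-K (2 * n)) (suc k)) (hasIntervalColoring product)
   in W , isGreatest , ≤-trans (≤-reflexive (trans (cong (_* suc k) t≡) (*-comm t (suc k)))) kt≤W)
  where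
  product : Regular (Hyp n (suc k)) (suc k * r) (suc k * t)
  product = subst (λ N → Regular (K N ^□ suc k) (suc k * r) (suc k * t)) 1+r≡2n
                  (regular-^□ (finite-K (suc r)) R k)

  fewest : HasIntervalColoring (Hyp n (suc k)) (suc k * r)
  fewest = hasIntervalColoring (reduced product)

  -- Nothing is truncated, because 4n is exactly t + 2 + p + q.
  t≡ : 4 * n ∸ 2 ∸ suc m ∸ q ≡ t
  t≡ = begin
    4 * n ∸ 2 ∸ suc m ∸ q                  ≡⟨ cong (_∸ q) (∸-+-assoc (4 * n) 2 (suc m)) ⟩
    4 * n ∸ (2 + suc m) ∸ q                ≡⟨ ∸-+-assoc (4 * n) (2 + suc m) q ⟩
    4 * n ∸ (2 + suc m + q)                ≡⟨ cong (_∸ (2 + suc m + q)) eq ⟨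
    t + (2 + suc m + q) ∸ (2 + suc m + q)  ≡⟨ m+n∸n≡m t (2 + suc m + q) ⟩
    t                                      ∎
    where open ≡-Reasoning
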